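{- Let $n_1\ge n_2\ge n_3\ge 1$ be integers. Then $\mathrm{ex}(K_{n_1,n_2,n_3}, C_4^{\text{multi}})=n_1n_2+2n_3$.
   Context: $K_{n_1,n_2,n_3}$ denotes the complete $3$-partite graph with parts $V_1,V_2,V_3$ of sizes $n_1,n_2,n_3$. A subgraph $H$ of a $3$-partite graph with parts $V_1,V_2,V_3$ is called multipartite if $V(H)$ meets all three parts; $C_4^{\text{multi}}$ denotes a multipartite $4$-cycle, i.e. a cycle of length $4$ containing at least one vertex in each of the three parts. For a host graph $G$ and a family $\mathcal{F}$ of (here: multipartite) subgraphs, $\mathrm{ex}(G,\mathcal{F})$ is the maximum number of edges of a subgraph $H\subseteq G$ containing no member of $\mathcal{F}$ as a subgraph; $\mathrm{ex}(K_{n_1,n_2,n_3}, C_4^{\text{multi}})$ is the maximum number of edges of a subgraph of $K_{n_1,n_2,n_3}$ containing no $C_4^{\text{multi}}$. -}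

module Defs where

open import Data.Nat using (ℕ; zero; suc; _+_; _*_; _≤_)
open import Data.Fin using (Fin)
import Data.Fin as F
open import Data.Bool using (Bool; true; false; if_then_else_)
open import Data.Product using (Σ; _×_; ∃; _,_)
open import Data.Sum using (_⊎_)
open import Data.Empty using (⊥)
open import Relation.Nullary using (¬_)
open import Relation.Binary.PropositionalEquality using (_≡_)

data Vtx (n₁ n₂ n₃ : ℕ) : Set where
  v₁ : Fin n₁ → Vtx n₁ n₂ n₃
  v₂ : Fin n₂ → Vtx n₁ n₂ n₃
  v₃ : Fin n₃ → Vtx n₁ n₂ n₃

part : ∀ {n₁ n₂ n₃} → Vtx n₁ n₂ n₃ → Fin 3
part (v₁ _) = F.zero
part (v₂ _) = F.suc F.zero
part (v₃ _) = F.suc (F.suc F.zero)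

-- A (spanning) subgraph of K_{n1,n2,n3}: for each pair of parts, which of
-- the complete bipartite edges between them are kept.
record Sub (n₁ n₂ n₃ : ℕ) : Set where
  field
    e₁₂ : Fin n₁ → Fin n₂ → Bool
    e₁₃ : Fin n₁ → Fin n₃ → Bool
    e₂₃ : Fin n₂ → Fin n₃ → Bool
open Sub public

Adj : ∀ {n₁ n₂ n₃} → Sub n₁ n₂ n₃ → Vtx n₁ n₂ n₃ → Vtx n₁ n₂ n₃ → Set
Adj H (v₁ a) (v₂ b) = e₁₂ H a b ≡ true
Adj H (v₂ b) (v₁ a) = e₁₂ H a b ≡ true
Adj H (v₁ a) (v₃ c) = e₁₃ H a c ≡ true
Adj H (v₃ c) (v₁ a) = e₁₃ H a c ≡ true
Adj H (v₂ b) (v₃ c) = e₂₃ H b c ≡ true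
Adj H (v₃ c) (v₂ b) = e₂₃ H b c ≡ true
Adj H _ _ = ⊥

sumFin : ∀ {n} → (Fin n → ℕ) → ℕ
sumFin {zero} f = 0
sumFin {suc n} f = f F.zero + sumFin (λ i → f (F.suc i))

b2n : Bool → ℕ
b2n b = if b then 1 else 0

countRel : ∀ {m n} → (Fin m → Fin n → Bool) → ℕ
countRel R = sumFin (λ i → sumFin (λ j → b2n (R i j)))

edges : ∀ {n₁ n₂ n₃} → Sub n₁ n₂ n₃ → ℕ
edges H = countRel (e₁₂ H) + countRel (e₁₃ H) + countRel (e₂₃ H)

HasMultiC4 : ∀ {n₁ n₂ n₃} → Sub n₁ n₂ n₃ → Set
HasMultiC4 {n₁} {n₂} {n₃} H =
  Σ (Vtx n₁ n₂ n₃) λ a → Σ (Vtx n₁ n₂ n₃) λ b →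
  Σ (Vtx n₁ n₂ n₃) λ c → Σ (Vtx n₁ n₂ n₃) λ d →
    (¬ a ≡ b) × (¬ a ≡ c) × (¬ a ≡ d) × (¬ b ≡ c) × (¬ b ≡ d) × (¬ c ≡ d) ×
    Adj H a b × Adj H b c × Adj H c d × Adj H d a ×
    ((i : Fin 3) → (part a ≡ i) ⊎ (part b ≡ i) ⊎ (part c ≡ i) ⊎ (part d ≡ i))

IsEx : ℕ → ℕ → ℕ → ℕ → Set
IsEx n₁ n₂ n₃ m =
  ((H : Sub n₁ n₂ n₃) → ¬ HasMultiC4 H → edges H ≤ m) ×
  (Σ (Sub n₁ n₂ n₃) λ H → ¬ HasMultiC4 H × edges H ≡ m)

{-# OPTIONS --safe #-}
module Submission where

-- For c in V₃ let x and y be its numbers of neighbours in V₁ and V₂. The products N₁(c) × N₂(c)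
-- are pairwise disjoint and H has only a matching inside each, so at least xy − min(x, y) pairs of
-- V₁ × V₂ are non-edges on account of c. This pays for the surplus x + y − 2 of c unless c sees one
-- side only and has at least three neighbours there. Suppose then that y = 0 and x ≥ 3 for some c,
-- and induct on n₃ (only n₃ ≤ n₁ and n₃ ≤ n₂ matter, so the parts V₁ and V₂ are interchangeable).
-- If every vertex of V₃ has at most one neighbour in V₂, then x − 1 ≤ |V₁ ∖ N₁(b)| for all b and c,
-- and an injection V₃ → V₂ distributes the surpluses. Otherwise some b ≠ b′ have a common neighbour
-- in V₃, hence none in V₁; taking a in N₁(c) with x · |N₂(a)| ≤ n₂, one of the triples (a, b, c),
-- (a, b′, c) can be deleted at a cost of at most n₁ + n₂ + 1 edges, except when n₁ = n₂ = n₃ = x.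
-- In that case there are at most n₂ edges between V₁ and V₂, and |N₃(a)| + |N₃(b)| ≤ n₃ + 1 summed
-- over a pairing of V₁ with V₂ finishes. The bound is attained by K_{n₁,n₂} with each c joined to
-- its own edge of a matching.

open import Defs
open import Data.Nat using (ℕ; _+_; _*_; _≤_)

open import Algebra.Bundles using (CommutativeSemiring)
open import Data.Bool using (Bool; true; false; not; _∧_)
import Data.Bool as Bool
open import Data.Empty using (⊥)
open import Data.Fin using (Fin; punchIn; inject≤)
import Data.Fin as F
open import Data.Fin.Properties using (any?; punchIn-injective; inject≤-injective)
import Data.Fin.Properties as F
open import Data.Nat using (zero; suc; z≤n; s≤s; s≤s⁻¹; _≤?_; >-nonZero)
open import Data.Nat.Properties
open import Data.Nat.Tactic.RingSolver using (solve-∀)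
open import Data.Product using (_×_; _,_; ∃; proj₁; proj₂)
open import Data.Sum using (_⊎_; inj₁; inj₂; [_,_])
open import Function using (_∘_; flip)
open import Relation.Binary.PropositionalEquality using (_≡_; _≢_; refl; sym; trans; cong; cong₂; subst; module ≡-Reasoning)
open import Relation.Nullary using (¬_; Dec; yes; no; contradiction; does; ¬?)
open import Relation.Nullary.Decidable using (_×-dec_)

open import Algebra.Properties.Semiring.Sum (CommutativeSemiring.semiring +-*-commutativeSemiring)
  using (sum; sum-remove; ∑-distrib-+; ∑-comm; *-distribˡ-sum)

private
  variable
    m n n₁ n₂ n₃ : ℕ

-- Finite sums of natural numbers.

sumFin≡sum : (f : Fin n → ℕ) → sumFin f ≡ sum f
sumFin≡sum {zero}  f = refl
sumFin≡sum {suc n} f = cong (f F.zero +_) (sumFin≡sum (f ∘ F.suc))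

sumFin-cong : {f g : Fin n → ℕ} → (∀ i → f i ≡ g i) → sumFin f ≡ sumFin g
sumFin-cong {zero}  f≗g = refl
sumFin-cong {suc n} f≗g = cong₂ _+_ (f≗g F.zero) (sumFin-cong (f≗g ∘ F.suc))

sumFin-mono : {f g : Fin n → ℕ} → (∀ i → f i ≤ g i) → sumFin f ≤ sumFin g
sumFin-mono {zero}  f≤g = z≤n
sumFin-mono {suc n} f≤g = +-mono-≤ (f≤g F.zero) (sumFin-mono (f≤g ∘ F.suc))

sumFin-const : ∀ n k → sumFin {n} (λ _ → k) ≡ n * k
sumFin-const zero    k = refl
sumFin-const (suc n) k = cong (k +_) (sumFin-const n k)

sumFin-+ : (f g : Fin n → ℕ) → sumFin (λ i → f i + g i) ≡ sumFin f + sumFin g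
sumFin-+ f g = trans (sumFin≡sum (λ i → f i + g i)) (trans (∑-distrib-+ f g)
  (sym (cong₂ _+_ (sumFin≡sum f) (sumFin≡sum g))))

sumFin-*ˡ : ∀ k (f : Fin n → ℕ) → sumFin (λ i → k * f i) ≡ k * sumFin f
sumFin-*ˡ k f = trans (sumFin≡sum (λ i → k * f i))
  (trans (sym (*-distribˡ-sum k f)) (cong (k *_) (sym (sumFin≡sum f))))

sumFin-*ʳ : ∀ k (f : Fin n → ℕ) → sumFin (λ i → f i * k) ≡ sumFin f * k
sumFin-*ʳ k f = trans (sumFin-cong (λ i → *-comm (f i) k)) (trans (sumFin-*ˡ k f) (*-comm k _))

sumFin-swap : (f : Fin m → Fin n → ℕ) →
  sumFin (λ i → sumFin (λ j → f i j)) ≡ sumFin (λ j → sumFin (λ i → f i j))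
sumFin-swap f = trans (double f) (trans (∑-comm f) (sym (double (flip f))))
  where
  double : ∀ {m n} (f : Fin m → Fin n → ℕ) →
    sumFin (λ i → sumFin (f i)) ≡ sum (λ i → sum (f i))
  double f = trans (sumFin-cong (λ i → sumFin≡sum (f i))) (sumFin≡sum (λ i → sum (f i)))

sumFin-remove : (i : Fin (suc n)) (f : Fin (suc n) → ℕ) →
  sumFin f ≡ f i + sumFin (f ∘ punchIn i)
sumFin-remove i f = trans (sumFin≡sum f) (trans (sum-remove {i = i} f)
  (cong (f i +_) (sym (sumFin≡sum (f ∘ punchIn i)))))

sumFin-inject≤ : (m≤n : m ≤ n) (f : Fin n → ℕ) → sumFin (λ i → f (inject≤ i m≤n)) ≤ sumFin f
sumFin-inject≤ z≤n       f = z≤n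
sumFin-inject≤ (s≤s m≤n) f = +-monoʳ-≤ (f F.zero) (sumFin-inject≤ m≤n (f ∘ F.suc))

-- Cardinalities of finite sets given by Boolean predicates.

count : (Fin n → Bool) → ℕ
count p = sumFin (λ i → b2n (p i))

b2n≤1 : ∀ b → b2n b ≤ 1
b2n≤1 true  = ≤-refl
b2n≤1 false = z≤n

count≤n : (p : Fin n → Bool) → count p ≤ n
count≤n {n} p = ≤-trans (sumFin-mono (b2n≤1 ∘ p))
  (≤-reflexive (trans (sumFin-const n 1) (*-identityʳ n)))

count-true : ∀ n → count {n} (λ _ → true) ≡ n
count-true n = trans (sumFin-const n 1) (*-identityʳ n)

count-false : ∀ n → count {n} (λ _ → false) ≡ 0
count-false n = trans (sumFin-const n 0) (*-zeroʳ n)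

count-not : (p : Fin n → Bool) → count p + count (not ∘ p) ≡ n
count-not {n} p = trans (sym (sumFin-+ (b2n ∘ p) (b2n ∘ not ∘ p)))
  (trans (sumFin-cong (complement ∘ p)) (count-true n))
  where
  complement : ∀ b → b2n b + b2n (not b) ≡ 1
  complement true  = refl
  complement false = refl

AtMostOne : (Fin n → Bool) → Set
AtMostOne p = ∀ {i j} → i ≢ j → p i ≡ true → p j ≡ true → ⊥

AtMostOneCommon : (p q : Fin n → Bool) → Set
AtMostOneCommon p q =
  ∀ {i j} → i ≢ j → p i ≡ true → p j ≡ true → q i ≡ true → q j ≡ true → ⊥

count-atMostOne : (p : Fin n → Bool) → AtMostOne p → count p ≤ 1
count-atMostOne {zero}  p one = z≤n
count-atMostOne {suc n} p one with p F.zero in p0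
... | false = count-atMostOne (p ∘ F.suc) (λ i≢j → one (i≢j ∘ F.suc-injective))
... | true  = s≤s (≤-trans (sumFin-mono rest) (≤-reflexive (count-false n)))
  where
  rest : ∀ i → b2n (p (F.suc i)) ≤ 0
  rest i with p (F.suc i) in pi
  ... | false = z≤n
  ... | true  = contradiction pi (λ pi → one (λ ()) p0 pi)

∧-true : ∀ {b c} → b ∧ c ≡ true → b ≡ true × c ≡ true
∧-true {true} {true} _ = refl , refl

atMostOne-∧ : {p q : Fin n → Bool} → AtMostOneCommon p q → AtMostOne (λ i → p i ∧ q i)
atMostOne-∧ one i≢j pqi pqj = one i≢j
  (proj₁ (∧-true pqi)) (proj₁ (∧-true pqj)) (proj₂ (∧-true pqi)) (proj₂ (∧-true pqj))

count-∧≤1 : {p q : Fin n → Bool} → AtMostOneCommon p q → count (λ i → p i ∧ q i) ≤ 1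
count-∧≤1 one = count-atMostOne _ (atMostOne-∧ one)

-- Inclusion-exclusion with an overlap of at most one. It is applied to the neighbourhoods, in the
-- third part, of two vertices from different parts.
count-+≤n+1 : {p q : Fin n → Bool} → AtMostOneCommon p q → count p + count q ≤ n + 1
count-+≤n+1 {n} {p} {q} one = begin
  count p + count q                               ≡⟨ sumFin-+ (b2n ∘ p) (b2n ∘ q) ⟨
  sumFin (λ i → b2n (p i) + b2n (q i))            ≤⟨ sumFin-mono (λ i → incl (p i) (q i)) ⟩
  sumFin (λ i → 1 + b2n (p i ∧ q i))              ≡⟨ sumFin-+ (λ _ → 1) (λ i → b2n (p i ∧ q i)) ⟩
  count {n} (λ _ → true) + count (λ i → p i ∧ q i) ≤⟨ +-mono-≤ (≤-reflexive (count-true n)) (count-∧≤1 one) ⟩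
  n + 1                                           ∎
  where
  open ≤-Reasoning
  incl : ∀ b c → b2n b + b2n c ≤ 1 + b2n (b ∧ c)
  incl true  true  = ≤-refl
  incl true  false = ≤-refl
  incl false true  = ≤-refl
  incl false false = z≤n

-- When triples are summed over one vertex, `g` is the condition that does not involve that vertex;
-- what remains is a set of common neighbours.
count-guard : ∀ g {p q : Fin n → Bool} → AtMostOneCommon p q →
  count (λ i → g ∧ (p i ∧ q i)) ≤ b2n g
count-guard     true  one = count-∧≤1 one
count-guard {n} false one = ≤-reflexive (count-false n)

-- Averaging over the set `p` without division: if `count p * f i` exceeded `N` throughout the set,
-- summation would give `k * suc N ≤ k * N`.
exists-average : (p : Fin n → Bool) (f : Fin n → ℕ) (N : ℕ) → 1 ≤ count p →
  sumFin (λ i → b2n (p i) * f i) ≤ N → ∃ λ i → p i ≡ true × count p * f i ≤ N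
exists-average p f N 1≤k total
  with any? (λ i → (p i Bool.≟ true) ×-dec (count p * f i ≤? N))
... | yes found = found
... | no  none  = contradiction (*-cancelˡ-≤ (count p) {{>-nonZero 1≤k}} too-many) (<⇒≱ ≤-refl)
  where
  open ≤-Reasoning
  k = count p
  large : ∀ i → b2n (p i) * suc N ≤ k * (b2n (p i) * f i)
  large i with p i in pi
  ... | false = z≤n
  ... | true rewrite *-identityˡ (suc N) | *-identityˡ (f i) = ≰⇒> (λ small → none (i , pi , small))
  too-many : k * suc N ≤ k * N
  too-many = begin
    k * suc N                              ≡⟨ sumFin-*ʳ (suc N) (b2n ∘ p) ⟨
    sumFin (λ i → b2n (p i) * suc N)       ≤⟨ sumFin-mono large ⟩
    sumFin (λ i → k * (b2n (p i) * f i))   ≡⟨ sumFin-*ˡ k (λ i → b2n (p i) * f i) ⟩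
    k * sumFin (λ i → b2n (p i) * f i)     ≤⟨ *-monoʳ-≤ k total ⟩
    k * N                                  ∎

count-≟ : (j : Fin n) → count (λ i → does (i F.≟ j)) ≡ 1
count-≟ {suc n} F.zero    = cong suc (count-false n)
count-≟ {suc n} (F.suc j) = count-≟ j

-- Row `a` and column `b` both contain the entry where they cross, hence the correction on the left,
-- which avoids subtraction.
countRel-remove : (R : Fin (suc m) → Fin (suc n) → Bool) → ∀ a b →
  countRel R + b2n (R a b) ≡
  count (R a) + count (λ i → R i b) + countRel (λ i j → R (punchIn a i) (punchIn b j))
countRel-remove R a b = begin
  countRel R + r                                     ≡⟨ cong (_+ r) (sumFin-remove a (λ i → count (R i))) ⟩
  count (R a) + sumFin (λ i → count (R (punchIn a i))) + r
    ≡⟨ cong (λ z → count (R a) + z + r)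
         (trans (sumFin-cong (λ i → sumFin-remove b (λ j → b2n (R (punchIn a i) j)))) (sumFin-+ (λ i → b2n (R (punchIn a i) b)) (λ i → count (R (punchIn a i) ∘ punchIn b)))) ⟩
  count (R a) + (col + rest) + r                     ≡⟨ shuffle (count (R a)) col rest r ⟩
  count (R a) + (r + col) + rest
    ≡⟨ cong (λ z → count (R a) + z + rest) (sumFin-remove a (λ i → b2n (R i b))) ⟨
  count (R a) + count (λ i → R i b) + rest           ∎
  where
  open ≡-Reasoning
  r = b2n (R a b)
  col = sumFin (λ i → b2n (R (punchIn a i) b))
  rest = countRel (λ i j → R (punchIn a i) (punchIn b j))
  shuffle : ∀ w x y z → w + (x + y) + z ≡ w + (z + x) + y
  shuffle = solve-∀

-- Multipartite 4-cycles and common neighbours.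

-- A multipartite C₄ has exactly two vertices in one part, opposite each other, so its absence
-- says that two vertices in different parts have at most one common neighbour in the third.
record Free (H : Sub n₁ n₂ n₃) : Set where
  field
    common₁ : ∀ b c → AtMostOneCommon (λ a → e₁₂ H a b) (λ a → e₁₃ H a c)
    common₂ : ∀ a c → AtMostOneCommon (λ b → e₁₂ H a b) (λ b → e₂₃ H b c)
    common₃ : ∀ a b → AtMostOneCommon (λ c → e₁₃ H a c) (λ c → e₂₃ H b c)
open Free

¬HasMultiC4⇒Free : (H : Sub n₁ n₂ n₃) → ¬ HasMultiC4 H → Free H
¬HasMultiC4⇒Free H none .common₁ b c {i} {j} i≢j ib jb ic jc =
  none (v₁ i , v₂ b , v₁ j , v₃ c , (λ ()) , (λ { refl → i≢j refl }) , (λ ()) , (λ ()) , (λ ()) , (λ ())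
       , ib , jb , jc , ic
       , λ { F.zero → inj₁ refl ; (F.suc F.zero) → inj₂ (inj₁ refl)
           ; (F.suc (F.suc F.zero)) → inj₂ (inj₂ (inj₂ refl)) })
¬HasMultiC4⇒Free H none .common₂ a c {i} {j} i≢j ai aj ic jc =
  none (v₂ i , v₁ a , v₂ j , v₃ c , (λ ()) , (λ { refl → i≢j refl }) , (λ ()) , (λ ()) , (λ ()) , (λ ())
       , ai , aj , jc , ic
       , λ { F.zero → inj₂ (inj₁ refl) ; (F.suc F.zero) → inj₁ refl
           ; (F.suc (F.suc F.zero)) → inj₂ (inj₂ (inj₂ refl)) })
¬HasMultiC4⇒Free H none .common₃ a b {i} {j} i≢j ai aj bi bj =
  none (v₃ i , v₁ a , v₃ j , v₂ b , (λ ()) , (λ { refl → i≢j refl }) , (λ ()) , (λ ()) , (λ ()) , (λ ())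
       , ai , aj , bj , bi
       , λ { F.zero → inj₂ (inj₁ refl) ; (F.suc F.zero) → inj₂ (inj₂ (inj₂ refl))
           ; (F.suc (F.suc F.zero)) → inj₁ refl })

avoids : {p q i : Fin 3} → p ≢ i → q ≢ i → ¬ (p ≡ i ⊎ q ≡ i ⊎ p ≡ i ⊎ q ≡ i)
avoids p≢i q≢i = [ p≢i , [ q≢i , [ p≢i , q≢i ] ] ]

-- Adjacent vertices lie in different parts, which leaves 18 patterns. In twelve, one opposite pair
-- shares a part and the other pair occupies the two remaining parts, against `Free`; the last six
-- meet only two parts.
Free⇒¬HasMultiC4 : (H : Sub n₁ n₂ n₃) → Free H → ¬ HasMultiC4 H
Free⇒¬HasMultiC4 {n₁} {n₂} {n₃} H free
  (a , b , c , d , _ , a≢c , _ , _ , b≢d , _ , ab , bc , cd , da , parts) =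
  go a b c d a≢c b≢d ab bc cd da parts
  where
  go : (a b c d : Vtx n₁ n₂ n₃) → a ≢ c → b ≢ d → Adj H a b → Adj H b c → Adj H c d → Adj H d a →
    ((i : Fin 3) → (part a ≡ i) ⊎ (part b ≡ i) ⊎ (part c ≡ i) ⊎ (part d ≡ i)) → ⊥
  go (v₁ a) (v₂ b) (v₁ c) (v₃ d) ac bd e f g h _ = common₁ free b d (ac ∘ cong v₁) e f h g
  go (v₁ a) (v₃ b) (v₁ c) (v₂ d) ac bd e f g h _ = common₁ free d b (ac ∘ cong v₁) h g e f
  go (v₂ a) (v₁ b) (v₂ c) (v₃ d) ac bd e f g h _ = common₂ free b d (ac ∘ cong v₂) e f h g
  go (v₂ a) (v₃ b) (v₂ c) (v₁ d) ac bd e f g h _ = common₂ free d b (ac ∘ cong v₂) h g e f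
  go (v₃ a) (v₁ b) (v₃ c) (v₂ d) ac bd e f g h _ = common₃ free b d (ac ∘ cong v₃) e f h g
  go (v₃ a) (v₂ b) (v₃ c) (v₁ d) ac bd e f g h _ = common₃ free d b (ac ∘ cong v₃) h g e f
  go (v₂ a) (v₁ b) (v₃ c) (v₁ d) ac bd e f g h _ = common₁ free a c (bd ∘ cong v₁) e h f g
  go (v₃ a) (v₁ b) (v₂ c) (v₁ d) ac bd e f g h _ = common₁ free c a (bd ∘ cong v₁) f g e h
  go (v₁ a) (v₂ b) (v₃ c) (v₂ d) ac bd e f g h _ = common₂ free a c (bd ∘ cong v₂) e h f g
  go (v₃ a) (v₂ b) (v₁ c) (v₂ d) ac bd e f g h _ = common₂ free c a (bd ∘ cong v₂) f g e h
  go (v₁ a) (v₃ b) (v₂ c) (v₃ d) ac bd e f g h _ = common₃ free a c (bd ∘ cong v₃) e h f g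
  go (v₂ a) (v₃ b) (v₁ c) (v₃ d) ac bd e f g h _ = common₃ free c a (bd ∘ cong v₃) f g e h
  go (v₁ _) (v₂ _) (v₁ _) (v₂ _) _ _ _ _ _ _ parts = avoids (λ ()) (λ ()) (parts (F.suc (F.suc F.zero)))
  go (v₂ _) (v₁ _) (v₂ _) (v₁ _) _ _ _ _ _ _ parts = avoids (λ ()) (λ ()) (parts (F.suc (F.suc F.zero)))
  go (v₁ _) (v₃ _) (v₁ _) (v₃ _) _ _ _ _ _ _ parts = avoids (λ ()) (λ ()) (parts (F.suc F.zero))
  go (v₃ _) (v₁ _) (v₃ _) (v₁ _) _ _ _ _ _ _ parts = avoids (λ ()) (λ ()) (parts (F.suc F.zero))
  go (v₂ _) (v₃ _) (v₂ _) (v₃ _) _ _ _ _ _ _ parts = avoids (λ ()) (λ ()) (parts F.zero)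
  go (v₃ _) (v₂ _) (v₃ _) (v₂ _) _ _ _ _ _ _ parts = avoids (λ ()) (λ ()) (parts F.zero)

-- Exchanging V₁ with V₂, and deleting one vertex from each part.

swapParts : Sub n₁ n₂ n₃ → Sub n₂ n₁ n₃
swapParts H = record { e₁₂ = flip (e₁₂ H) ; e₁₃ = e₂₃ H ; e₂₃ = e₁₃ H }

swapParts-free : {H : Sub n₁ n₂ n₃} → Free H → Free (swapParts H)
swapParts-free free .common₁ = common₂ free
swapParts-free free .common₂ = common₁ free
swapParts-free free .common₃ a b i≢j p q r s = common₃ free b a i≢j r s p q

swapParts-edges : (H : Sub n₁ n₂ n₃) → edges (swapParts H) ≡ edges H
swapParts-edges H = trans
  (cong (λ z → z + countRel (e₂₃ H) + countRel (e₁₃ H)) (sumFin-swap (λ b a → b2n (e₁₂ H a b))))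
  (shuffle (countRel (e₁₂ H)) (countRel (e₂₃ H)) (countRel (e₁₃ H)))
  where
  shuffle : ∀ x y z → x + y + z ≡ x + z + y
  shuffle = solve-∀

delete : Sub (suc n₁) (suc n₂) (suc n₃) → Fin (suc n₁) → Fin (suc n₂) → Fin (suc n₃) → Sub n₁ n₂ n₃
delete H a b c = record
  { e₁₂ = λ i j → e₁₂ H (punchIn a i) (punchIn b j)
  ; e₁₃ = λ i k → e₁₃ H (punchIn a i) (punchIn c k)
  ; e₂₃ = λ j k → e₂₃ H (punchIn b j) (punchIn c k)
  }

delete-free : {H : Sub (suc n₁) (suc n₂) (suc n₃)} → Free H → ∀ a b c → Free (delete H a b c)
delete-free free a b c .common₁ j k i≢i′ =
  common₁ free (punchIn b j) (punchIn c k) (i≢i′ ∘ punchIn-injective a _ _)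
delete-free free a b c .common₂ i k j≢j′ =
  common₂ free (punchIn a i) (punchIn c k) (j≢j′ ∘ punchIn-injective b _ _)
delete-free free a b c .common₃ i j k≢k′ =
  common₃ free (punchIn a i) (punchIn b j) (k≢k′ ∘ punchIn-injective c _ _)

-- Arithmetic of the two critical inequalities.

cancel-sum : ∀ s {l r l′ r′} → l′ ≡ s + l → r′ ≡ s + r → l′ ≤ r′ → l ≤ r
cancel-sum s refl refl = +-cancelˡ-≤ s _ _

-- Put `n₁ = x + w` and `n₂ = n₃ + u`. The last hypothesis becomes `w + 2 * u + 2 ≤ 2 * d`, so
-- `d = suc e`, and `3 * e ≤ x * e ≤ w + u ≤ 2 * e` forces `e`, `w` and `u` to vanish. This isolates
-- the case in which no deletion is cheap enough.
extremes-equal : ∀ {x d n₁ n₂ n₃} → 3 ≤ x → x ≤ n₁ → n₃ ≤ n₁ → n₃ ≤ n₂ → x * d ≤ n₂ →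
  n₁ + 2 * n₂ + 2 ≤ 2 * d + 2 * n₃ + x → n₁ ≡ x × n₂ ≡ x × n₃ ≡ x
extremes-equal {x} {d} {n₁} {n₂} {n₃} 3≤x x≤n₁ n₃≤n₁ n₃≤n₂ xd≤n₂ bound
  with m≤n⇒∃[o]m+o≡n x≤n₁ | m≤n⇒∃[o]m+o≡n n₃≤n₂
... | w , refl | u , refl = go d xd≤n₂
    (cancel-sum (x + 2 * n₃) (expandˡ x w n₃ u) (expandʳ x d n₃) bound)
  where
  expandˡ : ∀ x w n u → x + w + 2 * (n + u) + 2 ≡ (x + 2 * n) + (w + 2 * u + 2)
  expandˡ = solve-∀
  expandʳ : ∀ x d n → 2 * d + 2 * n + x ≡ (x + 2 * n) + 2 * d
  expandʳ = solve-∀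
  double-suc : ∀ e → 2 * suc e ≡ 2 + 2 * e
  double-suc = solve-∀
  triple : ∀ e → 3 * e ≡ 2 * e + e
  triple = solve-∀

  go : ∀ d → x * d ≤ n₃ + u → w + 2 * u + 2 ≤ 2 * d → x + w ≡ x × n₃ + u ≡ x × n₃ ≡ x
  go zero    _      2≤0  = contradiction (≤-trans (m≤n+m 2 (w + 2 * u)) 2≤0) λ ()
  go (suc e) xd≤n₂ slack = finish w+2u≤0
    where
    open ≤-Reasoning
    w+2u≤2e : w + 2 * u ≤ 2 * e
    w+2u≤2e = cancel-sum 2 (+-comm (w + 2 * u) 2) (double-suc e) slack
    -- One `x` is cancelled from `x * suc e ≤ n₃ + u ≤ x + w + u`.
    xe≤w+u : x * e ≤ w + u
    xe≤w+u = cancel-sum x (*-suc x e) (+-assoc x w u) (≤-trans xd≤n₂ (+-monoˡ-≤ u n₃≤n₁))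
    e≤0 : e ≤ 0
    e≤0 = cancel-sum (2 * e) (triple e) (sym (+-identityʳ (2 * e))) (begin
      3 * e     ≤⟨ *-monoˡ-≤ e 3≤x ⟩
      x * e     ≤⟨ xe≤w+u ⟩
      w + u     ≤⟨ +-monoʳ-≤ w (m≤m+n u (u + 0)) ⟩
      w + 2 * u ≤⟨ w+2u≤2e ⟩
      2 * e     ∎)
    w+2u≤0 : w + 2 * u ≤ 0
    w+2u≤0 = ≤-trans w+2u≤2e (*-monoʳ-≤ 2 e≤0)
    finish : w + 2 * u ≤ 0 → x + w ≡ x × n₃ + u ≡ x × n₃ ≡ x
    finish s≤0
      with refl ← n≤0⇒n≡0 (≤-trans (m≤m+n w (2 * u)) s≤0)
      with refl ← n≤0⇒n≡0 (≤-trans (m≤m+n u (u + 0)) (≤-trans (m≤n+m (2 * u) w) s≤0))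
      = +-identityʳ x , trans (+-identityʳ n₃) n₃≡x , n₃≡x
      where
      n₃≡x : n₃ ≡ x
      n₃≡x = ≤-antisym (subst (n₃ ≤_) (+-identityʳ x) n₃≤n₁)
        (subst (x ≤_) (+-identityʳ n₃) (≤-trans (m≤m*n x (suc e)) xd≤n₂))

-- An `x` by `y` product holds `t` edges of a matching and `m` non-edges. If a side is empty, the
-- hypotheses cap the other at two. For `y = 1` the bound `t ≤ y` is used; for `y ≥ 2` the bound
-- `t ≤ x` is, since x(y - 1) exceeds x + y - 2 by (x - 1)(y - 2).
matching-deficit : ∀ x y {t m} → (y ≡ 0 → x ≤ 2) → (x ≡ 0 → y ≤ 2) →
  t ≤ x → t ≤ y → t + m ≡ x * y → x + y ≤ 2 + m
matching-deficit x zero {t} {m} x≤2 _ _ _ _ =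
  ≤-trans (≤-reflexive (+-identityʳ x)) (≤-trans (x≤2 refl) (m≤m+n 2 m))
matching-deficit zero (suc y) {t} {m} _ y≤2 _ _ _ = ≤-trans (y≤2 refl) (m≤m+n 2 m)
matching-deficit (suc x) (suc zero) {t} {m} _ _ _ t≤1 split = begin
  suc x + 1          ≡⟨ +-comm (suc x) 1 ⟩
  1 + suc x          ≡⟨ cong suc (sym (*-identityʳ (suc x))) ⟩
  1 + suc x * 1      ≡⟨ cong suc split ⟨
  1 + (t + m)        ≤⟨ s≤s (+-monoˡ-≤ m t≤1) ⟩
  2 + m              ∎
  where open ≤-Reasoning
matching-deficit (suc x) (suc (suc y)) {t} {m} _ _ t≤x _ split = begin
  suc x + suc (suc y)      ≡⟨ regroup x y ⟩
  2 + (x + y + 1)          ≤⟨ +-monoʳ-≤ 2 (m≤m+n (x + y + 1) (x * y)) ⟩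
  2 + (x + y + 1 + x * y)  ≤⟨ +-monoʳ-≤ 2 (cancel-sum (suc x) (expand x y) refl
                                (≤-trans (≤-reflexive (sym split)) (+-monoˡ-≤ m t≤x))) ⟩
  2 + m                    ∎
  where
  open ≤-Reasoning
  regroup : ∀ x y → suc x + suc (suc y) ≡ 2 + (x + y + 1)
  regroup = solve-∀
  expand : ∀ x y → suc x * suc (suc y) ≡ suc x + (x + y + 1 + x * y)
  expand = solve-∀

-- Degrees, and charging the edges at V₃ to non-edges.

module _ (H : Sub n₁ n₂ n₃) where

  deg₁₂ : Fin n₁ → ℕ
  deg₁₂ a = count (e₁₂ H a)

  deg₁₃ : Fin n₁ → ℕ
  deg₁₃ a = count (e₁₃ H a)

  deg₂₁ : Fin n₂ → ℕ
  deg₂₁ b = count (λ a → e₁₂ H a b)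

  deg₂₃ : Fin n₂ → ℕ
  deg₂₃ b = count (e₂₃ H b)

  deg₃₁ : Fin n₃ → ℕ
  deg₃₁ c = count (λ a → e₁₃ H a c)

  deg₃₂ : Fin n₃ → ℕ
  deg₃₂ c = count (λ b → e₂₃ H b c)

  nonNbrs₂₁ : Fin n₂ → ℕ
  nonNbrs₂₁ b = count (λ a → not (e₁₂ H a b))

  -- Edges and non-edges between V₁ and V₂ total `n₁ * n₂`, so the edges at V₃ beyond two per vertex
  -- have to be paid for by non-edges. These are grouped by their end in V₂, which allows charging a
  -- whole vertex of V₂.
  edges-bound : sumFin (λ c → deg₃₁ c + deg₃₂ c) ≤ 2 * n₃ + sumFin nonNbrs₂₁ →
    edges H ≤ n₁ * n₂ + 2 * n₃
  edges-bound surplus = begin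
    countRel (e₁₂ H) + countRel (e₁₃ H) + countRel (e₂₃ H)
      ≡⟨ +-assoc (countRel (e₁₂ H)) _ _ ⟩
    countRel (e₁₂ H) + (countRel (e₁₃ H) + countRel (e₂₃ H))
      ≡⟨ cong₂ _+_ (sumFin-swap (λ a b → b2n (e₁₂ H a b)))
           (trans (cong₂ _+_ (sumFin-swap (λ a c → b2n (e₁₃ H a c))) (sumFin-swap (λ b c → b2n (e₂₃ H b c))))
                  (sym (sumFin-+ deg₃₁ deg₃₂))) ⟩
    sumFin deg₂₁ + sumFin (λ c → deg₃₁ c + deg₃₂ c)
      ≤⟨ +-monoʳ-≤ (sumFin deg₂₁) surplus ⟩
    sumFin deg₂₁ + (2 * n₃ + sumFin nonNbrs₂₁)
      ≡⟨ shuffle (sumFin deg₂₁) (2 * n₃) (sumFin nonNbrs₂₁) ⟩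
    sumFin deg₂₁ + sumFin nonNbrs₂₁ + 2 * n₃
      ≡⟨ cong (_+ 2 * n₃) (sumFin-+ deg₂₁ nonNbrs₂₁) ⟨
    sumFin (λ b → deg₂₁ b + nonNbrs₂₁ b) + 2 * n₃
      ≡⟨ cong (_+ 2 * n₃) (trans (sumFin-cong (λ b → count-not (λ a → e₁₂ H a b))) (sumFin-const n₂ n₁)) ⟩
    n₂ * n₁ + 2 * n₃
      ≡⟨ cong (_+ 2 * n₃) (*-comm n₂ n₁) ⟩
    n₁ * n₂ + 2 * n₃ ∎
    where
    open ≤-Reasoning
    shuffle : ∀ x y z → x + (y + z) ≡ x + z + y
    shuffle = solve-∀

  sumFin-2+ : (f : Fin n₃ → ℕ) → sumFin (λ c → 2 + f c) ≡ 2 * n₃ + sumFin f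
  sumFin-2+ f = trans (sumFin-+ (λ _ → 2) f)
    (cong (_+ sumFin f) (trans (sumFin-const n₃ 2) (*-comm n₃ 2)))

module _ {H : Sub n₁ n₂ n₃} (free : Free H) where

  bound-by-products :
    (∀ c → deg₃₂ H c ≡ 0 → deg₃₁ H c ≤ 2) → (∀ c → deg₃₁ H c ≡ 0 → deg₃₂ H c ≤ 2) →
    edges H ≤ n₁ * n₂ + 2 * n₃
  bound-by-products few₁ few₂ = edges-bound H (begin
    sumFin (λ c → deg₃₁ H c + deg₃₂ H c)
      ≤⟨ sumFin-mono (λ c → matching-deficit (deg₃₁ H c) (deg₃₂ H c) (few₁ c) (few₂ c)
           (present≤deg₃₁ c) (present≤deg₃₂ c) (present+absent c)) ⟩
    sumFin (λ c → 2 + absent c)    ≡⟨ sumFin-2+ H absent ⟩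
    2 * n₃ + sumFin absent         ≤⟨ +-monoʳ-≤ (2 * n₃) absent-disjoint ⟩
    2 * n₃ + sumFin (nonNbrs₂₁ H)  ∎)
    where
    open ≤-Reasoning

    -- Edges and non-edges inside N₁(c) × N₂(c). In each, the first conjunct is the guard that
    -- `count-guard` expects.
    present absent : Fin n₃ → ℕ
    present c = sumFin λ a → sumFin λ b → b2n (e₁₃ H a c ∧ (e₁₂ H a b ∧ e₂₃ H b c))
    absent c = sumFin λ a → sumFin λ b → b2n (not (e₁₂ H a b) ∧ (e₁₃ H a c ∧ e₂₃ H b c))

    present≤deg₃₁ : ∀ c → present c ≤ deg₃₁ H c
    present≤deg₃₁ c = sumFin-mono λ a → count-guard (e₁₃ H a c) (common₂ free a c)

    present≤deg₃₂ : ∀ c → present c ≤ deg₃₂ H c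
    present≤deg₃₂ c = begin
      present c
        ≡⟨ sumFin-swap (λ a b → b2n (e₁₃ H a c ∧ (e₁₂ H a b ∧ e₂₃ H b c))) ⟩
      sumFin (λ b → sumFin λ a → b2n (e₁₃ H a c ∧ (e₁₂ H a b ∧ e₂₃ H b c)))
        ≡⟨ sumFin-cong (λ b → sumFin-cong λ a → rotate (e₁₃ H a c) (e₁₂ H a b) (e₂₃ H b c)) ⟩
      sumFin (λ b → sumFin λ a → b2n (e₂₃ H b c ∧ (e₁₂ H a b ∧ e₁₃ H a c)))
        ≤⟨ sumFin-mono (λ b → count-guard (e₂₃ H b c) (common₁ free b c)) ⟩
      deg₃₂ H c ∎
      where
      rotate : ∀ p r q → b2n (p ∧ (r ∧ q)) ≡ b2n (q ∧ (r ∧ p))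
      rotate true  true  true  = refl
      rotate true  true  false = refl
      rotate true  false true  = refl
      rotate true  false false = refl
      rotate false true  true  = refl
      rotate false true  false = refl
      rotate false false true  = refl
      rotate false false false = refl

    present+absent : ∀ c → present c + absent c ≡ deg₃₁ H c * deg₃₂ H c
    present+absent c = begin-equality
      present c + absent c
        ≡⟨ sumFin-+ (λ a → sumFin λ b → b2n (e₁₃ H a c ∧ (e₁₂ H a b ∧ e₂₃ H b c)))
             (λ a → sumFin λ b → b2n (not (e₁₂ H a b) ∧ (e₁₃ H a c ∧ e₂₃ H b c))) ⟨
      sumFin (λ a → sumFin (λ b → b2n (e₁₃ H a c ∧ (e₁₂ H a b ∧ e₂₃ H b c)))
                  + sumFin (λ b → b2n (not (e₁₂ H a b) ∧ (e₁₃ H a c ∧ e₂₃ H b c))))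
        ≡⟨ sumFin-cong (λ a → trans
             (sym (sumFin-+ (λ b → b2n (e₁₃ H a c ∧ (e₁₂ H a b ∧ e₂₃ H b c)))
                            (λ b → b2n (not (e₁₂ H a b) ∧ (e₁₃ H a c ∧ e₂₃ H b c)))))
             (trans (sumFin-cong (λ b → split (e₁₃ H a c) (e₁₂ H a b) (e₂₃ H b c)))
                    (sumFin-*ˡ (b2n (e₁₃ H a c)) (λ b → b2n (e₂₃ H b c))))) ⟩
      sumFin (λ a → b2n (e₁₃ H a c) * deg₃₂ H c)
        ≡⟨ sumFin-*ʳ (deg₃₂ H c) (λ a → b2n (e₁₃ H a c)) ⟩
      deg₃₁ H c * deg₃₂ H c ∎
      where
      split : ∀ p r q → b2n (p ∧ (r ∧ q)) + b2n (not r ∧ (p ∧ q)) ≡ b2n p * b2n q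
      split true  true  true  = refl
      split true  true  false = refl
      split true  false true  = refl
      split true  false false = refl
      split false true  q     = refl
      split false false q     = refl

    -- By common₃ the products N₁(c) × N₂(c) are pairwise disjoint.
    absent-disjoint : sumFin absent ≤ sumFin (nonNbrs₂₁ H)
    absent-disjoint = begin
      sumFin absent
        ≡⟨ sumFin-swap (λ c a → sumFin λ b → b2n (not (e₁₂ H a b) ∧ (e₁₃ H a c ∧ e₂₃ H b c))) ⟩
      sumFin (λ a → sumFin λ c → sumFin λ b → b2n (not (e₁₂ H a b) ∧ (e₁₃ H a c ∧ e₂₃ H b c)))
        ≡⟨ sumFin-cong (λ a → sumFin-swap (λ c b → b2n (not (e₁₂ H a b) ∧ (e₁₃ H a c ∧ e₂₃ H b c)))) ⟩
      sumFin (λ a → sumFin λ b → sumFin λ c → b2n (not (e₁₂ H a b) ∧ (e₁₃ H a c ∧ e₂₃ H b c)))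
        ≤⟨ sumFin-mono (λ a → sumFin-mono λ b → count-guard (not (e₁₂ H a b)) (common₃ free a b)) ⟩
      sumFin (λ a → sumFin λ b → b2n (not (e₁₂ H a b)))
        ≡⟨ sumFin-swap (λ a b → b2n (not (e₁₂ H a b))) ⟩
      sumFin (nonNbrs₂₁ H) ∎

  -- For any `b`, all but at most one of the neighbours of `c` in V₁ are non-neighbours of `b`. That
  -- exception and the at most one neighbour of `c` in V₂ use up the allowance of two; `inject≤`
  -- keeps the charged vertices distinct.
  bound-by-injection : n₃ ≤ n₂ → (∀ c → deg₃₂ H c ≤ 1) → edges H ≤ n₁ * n₂ + 2 * n₃
  bound-by-injection n₃≤n₂ deg₃₂≤1 = edges-bound H (begin
    sumFin (λ c → deg₃₁ H c + deg₃₂ H c)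
      ≤⟨ sumFin-mono (λ c → +-mono-≤ (deg₃₁≤1+nonNbrs c (inject≤ c n₃≤n₂)) (deg₃₂≤1 c)) ⟩
    sumFin (λ c → 1 + nonNbrs₂₁ H (inject≤ c n₃≤n₂) + 1)
      ≡⟨ sumFin-cong (λ c → +-comm (1 + nonNbrs₂₁ H (inject≤ c n₃≤n₂)) 1) ⟩
    sumFin (λ c → 2 + nonNbrs₂₁ H (inject≤ c n₃≤n₂))
      ≡⟨ sumFin-2+ H (λ c → nonNbrs₂₁ H (inject≤ c n₃≤n₂)) ⟩
    2 * n₃ + sumFin (λ c → nonNbrs₂₁ H (inject≤ c n₃≤n₂))
      ≤⟨ +-monoʳ-≤ (2 * n₃) (sumFin-inject≤ n₃≤n₂ (nonNbrs₂₁ H)) ⟩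
    2 * n₃ + sumFin (nonNbrs₂₁ H) ∎)
    where
    open ≤-Reasoning
    deg₃₁≤1+nonNbrs : ∀ c b → deg₃₁ H c ≤ 1 + nonNbrs₂₁ H b
    deg₃₁≤1+nonNbrs c b = cancel-sum (deg₂₁ H b) refl
      (trans (+-comm _ 1) (trans (cong suc (sym (count-not (λ a → e₁₂ H a b))))
        (sym (+-suc (deg₂₁ H b) (nonNbrs₂₁ H b)))))
      (count-+≤n+1 (common₁ free b c))

  -- No `b` has two neighbours in N₁(c), so the sets N₂(a) with `a` in N₁(c) are pairwise disjoint
  -- and their sizes sum to at most `n₂`.
  exists-low-degree : ∀ c → 1 ≤ deg₃₁ H c →
    ∃ λ a → e₁₃ H a c ≡ true × deg₃₁ H c * deg₁₂ H a ≤ n₂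
  exists-low-degree c 1≤x = exists-average (λ a → e₁₃ H a c) (deg₁₂ H) n₂ 1≤x (begin
    sumFin (λ a → b2n (e₁₃ H a c) * deg₁₂ H a)
      ≡⟨ sumFin-cong (λ a → sym (sumFin-*ˡ (b2n (e₁₃ H a c)) (λ b → b2n (e₁₂ H a b)))) ⟩
    sumFin (λ a → sumFin λ b → b2n (e₁₃ H a c) * b2n (e₁₂ H a b))
      ≡⟨ sumFin-swap (λ a b → b2n (e₁₃ H a c) * b2n (e₁₂ H a b)) ⟩
    sumFin (λ b → sumFin λ a → b2n (e₁₃ H a c) * b2n (e₁₂ H a b))
      ≡⟨ sumFin-cong (λ b → sumFin-cong λ a → product (e₁₃ H a c) (e₁₂ H a b)) ⟩
    sumFin (λ b → count (λ a → e₁₂ H a b ∧ e₁₃ H a c))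
      ≤⟨ sumFin-mono (λ b → count-∧≤1 (common₁ free b c)) ⟩
    count {n₂} (λ _ → true)
      ≡⟨ count-true n₂ ⟩
    n₂ ∎)
    where
    open ≤-Reasoning
    product : ∀ p q → b2n p * b2n q ≡ b2n (q ∧ p)
    product true  true  = refl
    product true  false = refl
    product false true  = refl
    product false false = refl

  -- The common neighbour `c₀` makes N₁(b) and N₁(b′) disjoint, and each of them meets N₁(c) at most
  -- once.
  disjoint-nbrs : ∀ {b b′ c₀} → b ≢ b′ → e₂₃ H b c₀ ≡ true → e₂₃ H b′ c₀ ≡ true →
    ∀ c → deg₂₁ H b + deg₂₁ H b′ + deg₃₁ H c ≤ n₁ + 2
  disjoint-nbrs {b} {b′} {c₀} b≢b′ bc₀ b′c₀ c = begin
    deg₂₁ H b + deg₂₁ H b′ + deg₃₁ H c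
      ≡⟨ cong (_+ deg₃₁ H c) (sumFin-+ (λ a → b2n (e₁₂ H a b)) (λ a → b2n (e₁₂ H a b′))) ⟨
    sumFin (λ a → b2n (e₁₂ H a b) + b2n (e₁₂ H a b′)) + deg₃₁ H c
      ≡⟨ sumFin-+ (λ a → b2n (e₁₂ H a b) + b2n (e₁₂ H a b′)) (λ a → b2n (e₁₃ H a c)) ⟨
    sumFin (λ a → b2n (e₁₂ H a b) + b2n (e₁₂ H a b′) + b2n (e₁₃ H a c))
      ≤⟨ sumFin-mono (λ a → incl (e₁₂ H a b) (e₁₂ H a b′) (e₁₃ H a c)
           (λ ab ab′ → common₂ free a c₀ b≢b′ ab ab′ bc₀ b′c₀)) ⟩
    sumFin (λ a → 1 + (b2n (e₁₂ H a b ∧ e₁₃ H a c) + b2n (e₁₂ H a b′ ∧ e₁₃ H a c)))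
      ≡⟨ trans (sumFin-+ (λ _ → 1) (λ a → b2n (e₁₂ H a b ∧ e₁₃ H a c) + b2n (e₁₂ H a b′ ∧ e₁₃ H a c)))
           (cong₂ _+_ (count-true n₁)
             (sumFin-+ (λ a → b2n (e₁₂ H a b ∧ e₁₃ H a c)) (λ a → b2n (e₁₂ H a b′ ∧ e₁₃ H a c)))) ⟩
    n₁ + (count (λ a → e₁₂ H a b ∧ e₁₃ H a c) + count (λ a → e₁₂ H a b′ ∧ e₁₃ H a c))
      ≤⟨ +-monoʳ-≤ n₁ (+-mono-≤ (count-∧≤1 (common₁ free b c)) (count-∧≤1 (common₁ free b′ c))) ⟩
    n₁ + 2 ∎
    where
    open ≤-Reasoning
    incl : ∀ p q r → (p ≡ true → q ≡ true → ⊥) →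
      b2n p + b2n q + b2n r ≤ 1 + (b2n (p ∧ r) + b2n (q ∧ r))
    incl true  true  r     dis = contradiction refl (dis refl)
    incl true  false true  dis = ≤-refl
    incl true  false false dis = ≤-refl
    incl false true  true  dis = ≤-refl
    incl false true  false dis = ≤-refl
    incl false false r     dis = b2n≤1 r

  -- The two inequalities are added. `disjoint-nbrs` absorbs the degrees of `b` and `b′` into V₁
  -- along with one copy of `deg₃₁ H c`; the other copy survives in the conclusion.
  two-triples-heavy : ∀ {a b b′ c₀} c → b ≢ b′ → e₂₃ H b c₀ ≡ true → e₂₃ H b′ c₀ ≡ true →
    n₁ + n₂ + 3 ≤ deg₁₂ H a + deg₂₁ H b + (deg₁₃ H a + deg₂₃ H b) + deg₃₁ H c →
    n₁ + n₂ + 3 ≤ deg₁₂ H a + deg₂₁ H b′ + (deg₁₃ H a + deg₂₃ H b′) + deg₃₁ H c →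
    n₁ + 2 * n₂ + 2 ≤ 2 * deg₁₂ H a + 2 * n₃ + deg₃₁ H c
  two-triples-heavy {a} {b} {b′} c b≢b′ bc₀ b′c₀ heavy heavy′ =
    cancel-sum (n₁ + 4) (left n₁ n₂) (right n₁ n₃ d x) (begin
      (n₁ + n₂ + 3) + (n₁ + n₂ + 3)
        ≤⟨ +-mono-≤ heavy heavy′ ⟩
      (d + deg₂₁ H b + (deg₁₃ H a + deg₂₃ H b) + x) + (d + deg₂₁ H b′ + (deg₁₃ H a + deg₂₃ H b′) + x)
        ≤⟨ +-mono-≤ (+-monoˡ-≤ x (+-monoʳ-≤ (d + deg₂₁ H b) (count-+≤n+1 (common₃ free a b))))
                    (+-monoˡ-≤ x (+-monoʳ-≤ (d + deg₂₁ H b′) (count-+≤n+1 (common₃ free a b′)))) ⟩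
      (d + deg₂₁ H b + (n₃ + 1) + x) + (d + deg₂₁ H b′ + (n₃ + 1) + x)
        ≡⟨ shuffle d (deg₂₁ H b) (deg₂₁ H b′) n₃ x ⟩
      (deg₂₁ H b + deg₂₁ H b′ + x) + (2 * d + 2 * n₃ + 2 + x)
        ≤⟨ +-monoˡ-≤ _ (disjoint-nbrs b≢b′ bc₀ b′c₀ c) ⟩
      (n₁ + 2) + (2 * d + 2 * n₃ + 2 + x) ∎)
    where
    open ≤-Reasoning
    d = deg₁₂ H a
    x = deg₃₁ H c
    left : ∀ n₁ n₂ → (n₁ + n₂ + 3) + (n₁ + n₂ + 3) ≡ (n₁ + 4) + (n₁ + 2 * n₂ + 2)
    left = solve-∀
    right : ∀ n₁ n₃ d x → (n₁ + 2) + (2 * d + 2 * n₃ + 2 + x) ≡ (n₁ + 4) + (2 * d + 2 * n₃ + x)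
    right = solve-∀
    shuffle : ∀ d e e′ n x →
      (d + e + (n + 1) + x) + (d + e′ + (n + 1) + x) ≡ (e + e′ + x) + (2 * d + 2 * n + 2 + x)
    shuffle = solve-∀

-- Since `c` sees all of V₁, any two neighbours of `b` in V₁ would be common to `b` and `c`; so each
-- `b` has at most one.
bound-balanced : {H : Sub n n n} → Free H → ∀ c → deg₃₁ H c ≡ n → edges H ≤ n * n + 2 * n
bound-balanced {n} {H} free c full = begin
  countRel (e₁₂ H) + countRel (e₁₃ H) + countRel (e₂₃ H)
    ≡⟨ +-assoc (countRel (e₁₂ H)) _ _ ⟩
  countRel (e₁₂ H) + (sumFin (deg₁₃ H) + sumFin (deg₂₃ H))
    ≡⟨ cong₂ _+_ (sumFin-swap (λ a b → b2n (e₁₂ H a b))) (sym (sumFin-+ (deg₁₃ H) (deg₂₃ H))) ⟩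
  sumFin (deg₂₁ H) + sumFin (λ i → deg₁₃ H i + deg₂₃ H i)
    -- Vertex `i` of V₁ is paired with vertex `i` of V₂; the total n + n(n + 1) is exactly the
    -- bound.
    ≤⟨ +-mono-≤ (sumFin-mono deg₂₁≤1) (sumFin-mono (λ i → count-+≤n+1 (common₃ free i i))) ⟩
  sumFin {n} (λ _ → 1) + sumFin {n} (λ _ → n + 1)
    ≡⟨ cong₂ _+_ (sumFin-const n 1) (sumFin-const n (n + 1)) ⟩
  n * 1 + n * (n + 1)
    ≡⟨ shuffle n ⟩
  n * n + 2 * n ∎
  where
  open ≤-Reasoning
  shuffle : ∀ n → n * 1 + n * (n + 1) ≡ n * n + 2 * n
  shuffle = solve-∀
  deg₂₁≤1 : ∀ b → deg₂₁ H b ≤ 1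
  deg₂₁≤1 b = cancel-sum n (trans (cong (deg₂₁ H b +_) full) (+-comm (deg₂₁ H b) n)) refl
    (count-+≤n+1 (common₁ free b c))

-- The cost of deleting a triple.

edges-delete : (H : Sub (suc n₁) (suc n₂) (suc n₃)) → ∀ a b c →
  edges H + (b2n (e₁₂ H a b) + b2n (e₁₃ H a c) + b2n (e₂₃ H b c)) ≡
  deg₁₂ H a + deg₂₁ H b + (deg₁₃ H a + deg₂₃ H b) + deg₃₁ H c + deg₃₂ H c + edges (delete H a b c)
edges-delete H a b c = begin
  edges H + (b2n (e₁₂ H a b) + b2n (e₁₃ H a c) + b2n (e₂₃ H b c))
    ≡⟨ pair (countRel (e₁₂ H)) (countRel (e₁₃ H)) (countRel (e₂₃ H))
            (b2n (e₁₂ H a b)) (b2n (e₁₃ H a c)) (b2n (e₂₃ H b c)) ⟩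
  (countRel (e₁₂ H) + b2n (e₁₂ H a b)) + (countRel (e₁₃ H) + b2n (e₁₃ H a c))
    + (countRel (e₂₃ H) + b2n (e₂₃ H b c))
    ≡⟨ cong₂ _+_ (cong₂ _+_ (countRel-remove (e₁₂ H) a b) (countRel-remove (e₁₃ H) a c))
                 (countRel-remove (e₂₃ H) b c) ⟩
  (deg₁₂ H a + deg₂₁ H b + countRel (e₁₂ H′)) + (deg₁₃ H a + deg₃₁ H c + countRel (e₁₃ H′))
    + (deg₂₃ H b + deg₃₂ H c + countRel (e₂₃ H′))
    ≡⟨ collect (deg₁₂ H a) (deg₂₁ H b) (deg₁₃ H a) (deg₃₁ H c) (deg₂₃ H b) (deg₃₂ H c)
               (countRel (e₁₂ H′)) (countRel (e₁₃ H′)) (countRel (e₂₃ H′)) ⟩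
  deg₁₂ H a + deg₂₁ H b + (deg₁₃ H a + deg₂₃ H b) + deg₃₁ H c + deg₃₂ H c + edges H′ ∎
  where
  open ≡-Reasoning
  H′ = delete H a b c
  pair : ∀ e f g p q r → e + f + g + (p + q + r) ≡ (e + p) + (f + q) + (g + r)
  pair = solve-∀
  collect : ∀ s t u v w x e f g →
    (s + t + e) + (u + v + f) + (w + x + g) ≡ s + t + (u + w) + v + x + (e + f + g)
  collect = solve-∀

-- The target exceeds the bound for the smaller graph by `suc n₁ + suc n₂ + 1`. The degree sum may
-- be one larger because the edge from `a` to `c` is counted at both ends.
bound-from-delete : (H : Sub (suc n₁) (suc n₂) (suc n₃)) → ∀ a b c →
  e₁₃ H a c ≡ true → deg₃₂ H c ≡ 0 →
  deg₁₂ H a + deg₂₁ H b + (deg₁₃ H a + deg₂₃ H b) + deg₃₁ H c ≤ suc n₁ + suc n₂ + 2 →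
  edges (delete H a b c) ≤ n₁ * n₂ + 2 * n₃ → edges H ≤ suc n₁ * suc n₂ + 2 * suc n₃
bound-from-delete {n₁} {n₂} {n₃} H a b c ac y≡0 light rest =
  cancel-sum 1 (+-comm (edges H) 1) (expand n₁ n₂ n₃) (begin
    edges H + 1
      ≤⟨ +-monoʳ-≤ (edges H) 1≤ ⟩
    edges H + (b2n (e₁₂ H a b) + b2n (e₁₃ H a c) + b2n (e₂₃ H b c))
      ≡⟨ edges-delete H a b c ⟩
    deg₁₂ H a + deg₂₁ H b + (deg₁₃ H a + deg₂₃ H b) + deg₃₁ H c + deg₃₂ H c + edges (delete H a b c)
      ≤⟨ +-mono-≤ (+-mono-≤ light (≤-reflexive y≡0)) rest ⟩
    suc n₁ + suc n₂ + 2 + 0 + (n₁ * n₂ + 2 * n₃) ∎)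
  where
  open ≤-Reasoning
  1≤ : 1 ≤ b2n (e₁₂ H a b) + b2n (e₁₃ H a c) + b2n (e₂₃ H b c)
  1≤ rewrite ac = ≤-trans (m≤n+m 1 (b2n (e₁₂ H a b))) (m≤m+n _ _)
  expand : ∀ n₁ n₂ n₃ → suc n₁ + suc n₂ + 2 + 0 + (n₁ * n₂ + 2 * n₃)
    ≡ 1 + (suc n₁ * suc n₂ + 2 * suc n₃)
  expand = solve-∀

-- The upper bound, by induction on the size of V₃.

UpperBound : ℕ → Set
UpperBound n₃ = ∀ {n₁ n₂} (H : Sub n₁ n₂ n₃) → Free H → n₃ ≤ n₁ → n₃ ≤ n₂ →
  edges H ≤ n₁ * n₂ + 2 * n₃

one-sided-vertex : UpperBound n₃ → (H : Sub n₁ n₂ (suc n₃)) → Free H → suc n₃ ≤ n₁ → suc n₃ ≤ n₂ →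
  ∀ c → deg₃₂ H c ≡ 0 → 3 ≤ deg₃₁ H c → edges H ≤ n₁ * n₂ + 2 * suc n₃
one-sided-vertex {n₃} {suc n₁} {suc n₂} ih H free n₃≤n₁ n₃≤n₂ c y≡0 3≤x
  with any? (λ b → any? λ b′ → any? λ c₀ →
         ¬? (b F.≟ b′) ×-dec (e₂₃ H b c₀ Bool.≟ true) ×-dec (e₂₃ H b′ c₀ Bool.≟ true))
-- No two vertices of V₂ share a neighbour in V₃, so every `deg₃₂` is at most one.
... | no none = bound-by-injection free n₃≤n₂
        (λ c₀ → count-atMostOne (λ b → e₂₃ H b c₀)
          (λ b≢b′ bc b′c → none (_ , _ , c₀ , b≢b′ , bc , b′c)))
... | yes (b , b′ , c₀ , b≢b′ , bc₀ , b′c₀)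
  with exists-low-degree free c (≤-trans (s≤s z≤n) 3≤x)
... | a , ac , xd≤n₂ with light? b | light? b′
  where
  light? : ∀ b → Dec (deg₁₂ H a + deg₂₁ H b + (deg₁₃ H a + deg₂₃ H b) + deg₃₁ H c ≤ suc n₁ + suc n₂ + 2)
  light? b = _ ≤? _
-- One light triple suffices; both contain the edge from `a` to `c` that the deletion bound
-- requires.
... | yes light | _ = bound-from-delete H a b c ac y≡0 light
        (ih (delete H a b c) (delete-free free a b c) (s≤s⁻¹ n₃≤n₁) (s≤s⁻¹ n₃≤n₂))
... | no _ | yes light = bound-from-delete H a b′ c ac y≡0 light
        (ih (delete H a b′ c) (delete-free free a b′ c) (s≤s⁻¹ n₃≤n₁) (s≤s⁻¹ n₃≤n₂))
-- Two heavy triples force all parts to have size `deg₃₁ H c`, so `c` sees the whole of V₁.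
... | no heavy | no heavy′
  with extremes-equal 3≤x (count≤n (λ a → e₁₃ H a c)) n₃≤n₁ n₃≤n₂ xd≤n₂
         (two-triples-heavy free c b≢b′ bc₀ b′c₀ (≰⇒+3 heavy) (≰⇒+3 heavy′))
  where
  ≰⇒+3 : ∀ {k} → ¬ k ≤ suc n₁ + suc n₂ + 2 → suc n₁ + suc n₂ + 3 ≤ k
  ≰⇒+3 k≰ = ≤-trans (≤-reflexive (+-suc (suc n₁ + suc n₂) 2)) (≰⇒> k≰)
... | n₁≡x , n₂≡x , n₃≡x
  with refl ← trans n₁≡x (sym n₃≡x) | refl ← trans n₂≡x (sym n₃≡x) =
  bound-balanced free c (sym n₁≡x)

upperBound : ∀ n₃ → UpperBound n₃
-- With V₃ empty, the sum to be charged is empty.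
upperBound zero H free _ _ = edges-bound H z≤n
upperBound (suc n₃) {n₁} {n₂} H free n₃≤n₁ n₃≤n₂
  with any? (λ c → (deg₃₂ H c ≟ 0) ×-dec (3 ≤? deg₃₁ H c))
     | any? (λ c → (deg₃₁ H c ≟ 0) ×-dec (3 ≤? deg₃₂ H c))
... | yes (c , y≡0 , 3≤x) | _ =
  one-sided-vertex (upperBound n₃) H free n₃≤n₁ n₃≤n₂ c y≡0 3≤x
-- The size hypotheses are symmetric in V₁ and V₂, so a vertex seeing only V₂ is handled after
-- exchanging these parts.
... | no _ | yes (c , x≡0 , 3≤y) = begin
  edges H                    ≡⟨ swapParts-edges H ⟨
  edges (swapParts H)        ≤⟨ one-sided-vertex (upperBound n₃) (swapParts H) (swapParts-free free)
                                  n₃≤n₂ n₃≤n₁ c x≡0 3≤y ⟩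
  n₂ * n₁ + 2 * suc n₃       ≡⟨ cong (_+ 2 * suc n₃) (*-comm n₂ n₁) ⟩
  n₁ * n₂ + 2 * suc n₃       ∎
  where open ≤-Reasoning
... | no none₁ | no none₂ = bound-by-products free
  (λ c y≡0 → s≤s⁻¹ (≰⇒> (λ 3≤x → none₁ (c , y≡0 , 3≤x))))
  (λ c x≡0 → s≤s⁻¹ (≰⇒> (λ 3≤y → none₂ (c , x≡0 , 3≤y))))

-- The extremal graph.

module _ (n₃≤n₁ : n₃ ≤ n₁) (n₃≤n₂ : n₃ ≤ n₂) where

  extremal : Sub n₁ n₂ n₃
  extremal = record
    { e₁₂ = λ _ _ → true
    ; e₁₃ = λ a c → does (a F.≟ inject≤ c n₃≤n₁)
    ; e₂₃ = λ b c → does (b F.≟ inject≤ c n₃≤n₂)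
    }

  private
    does-≟ : (i j : Fin n) → does (i F.≟ j) ≡ true → i ≡ j
    does-≟ i j eq with yes i≡j ← i F.≟ j = i≡j

  -- Each `c` has a single neighbour in V₁ and a single one in V₂, and each `a` has at most one in
  -- V₃ because `inject≤` is injective.
  extremal-free : Free extremal
  extremal-free .common₁ _ c i≢j _ _ ic jc = i≢j (trans (does-≟ _ _ ic) (sym (does-≟ _ _ jc)))
  extremal-free .common₂ _ c i≢j _ _ ic jc = i≢j (trans (does-≟ _ _ ic) (sym (does-≟ _ _ jc)))
  extremal-free .common₃ a _ {i} {j} i≢j ai aj _ _ = i≢j (inject≤-injective n₃≤n₁ n₃≤n₁ i j
    (trans (sym (does-≟ a _ ai)) (does-≟ a _ aj)))

  extremal-edges : edges extremal ≡ n₁ * n₂ + 2 * n₃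
  extremal-edges = begin
    edges extremal             ≡⟨ cong₂ _+_ (cong₂ _+_ complete (matching n₃≤n₁)) (matching n₃≤n₂) ⟩
    n₁ * n₂ + n₃ + n₃          ≡⟨ shuffle (n₁ * n₂) n₃ ⟩
    n₁ * n₂ + 2 * n₃           ∎
    where
    open ≡-Reasoning
    shuffle : ∀ k n → k + n + n ≡ k + 2 * n
    shuffle = solve-∀
    complete : countRel (e₁₂ extremal) ≡ n₁ * n₂
    complete = trans (sumFin-cong {n₁} (λ _ → count-true n₂)) (sumFin-const n₁ n₂)
    matching : ∀ {n} (n₃≤n : n₃ ≤ n) → countRel (λ i c → does (i F.≟ inject≤ c n₃≤n)) ≡ n₃
    matching n₃≤n = trans (sumFin-swap (λ i c → b2n (does (i F.≟ inject≤ c n₃≤n))))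
      (trans (sumFin-cong (λ c → count-≟ (inject≤ c n₃≤n))) (count-true n₃))

theorem1 : (n₁ n₂ n₃ : ℕ) → n₂ ≤ n₁ → n₃ ≤ n₂ → 1 ≤ n₃ →
    IsEx n₁ n₂ n₃ (n₁ * n₂ + 2 * n₃)
theorem1 n₁ n₂ n₃ n₂≤n₁ n₃≤n₂ _ =
  (λ H none → upperBound n₃ H (¬HasMultiC4⇒Free H none) n₃≤n₁ n₃≤n₂) ,
  extremal n₃≤n₁ n₃≤n₂ ,
  Free⇒¬HasMultiC4 _ (extremal-free n₃≤n₁ n₃≤n₂) ,
  extremal-edges n₃≤n₁ n₃≤n₂
  where
  n₃≤n₁ = ≤-trans n₃≤n₂ n₂≤n₁
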